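{- Let $\mathcal C$ be a predicative topos. Let $\mathrm{Sub}\to\mathcal C$ be the subobject fibration (the Grothendieck construction of $\mathrm{Sub}:\mathcal C^{\mathrm{op}}\to\mathbf{Set}$), and let $\Sigma_\top:\mathcal C_{/1}\to\mathrm{Sub}$ be the functor over $\mathcal C$ induced by $\top:1\to\mathrm{Sub}$, sending an object $X$ to $(X,\text{the maximal subobject of }X)$. Then for every $\phi:y\Gamma\to\mathrm{Sub}$ the pullback of $\top$ along $\phi$ is representable by some object $\Gamma.\phi$ of $\mathcal C$, the functor $\Sigma_\top$ has a right adjoint $\Delta_\top$, and these data form a plain dependent type theory.
   Context: A presheaf $P:\mathcal C^{\mathrm{op}}\to\mathbf{Set}$ is a virtual object if it preserves all limits that exist. A subobject $P\to y c$ of a representable presheaf whose domain is a virtual object is called a virtual subobject of $c$ ($y$ is the Yoneda embedding). A predicative topos is a category $\mathcal C$ with finite limits such that: (i) $\mathcal C(-\times b,c)$ is a virtual object for all objects $b,c$; (ii) virtual subobjects are representable; (iii) the subobject functor $\mathrm{Sub}:\mathcal C^{\mathrm{op}}\to\mathbf{Set}$ is a virtual object. The map $\top:1\to\mathrm{Sub}$ picks the maximal subobject. Plain dependent type theory (pDTT): a category $\mathbf{ctx}$ (with terminal object), fibrations $u:\mathcal U\to\mathbf{ctx}$ and $\dot u:\dot{\mathcal U}\to\mathbf{ctx}$, a functor $\Sigma:\dot{\mathcal U}\to\mathcal U$ with $u\Sigma=\dot u$, and a right adjoint $\Delta:\mathcal U\to\dot{\mathcal U}$ of $\Sigma$ (not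 required to commute with the projections to $\mathbf{ctx}$), with unit $\eta$ and counit $\epsilon$, such that $\Sigma$ and $\Delta$ preserve cartesian morphisms and the components of $\eta$ and $\epsilon$ are cartesian. Here $\mathbf{ctx}=\mathcal C$, $\dot{\mathcal U}=\mathcal C_{/1}$, $\mathcal U=\mathrm{Sub}$. -}

module Defs where

open import Data.Fin.Base using (Fin; zero; suc)
open import Data.Fin.Patterns using (0F; 1F; 2F)
import Data.Fin.Properties as Fin
open import Data.Nat.Base using (ℕ)
open import Data.Product.Base using (Σ-syntax; _,_)
open import Data.Unit.Base using (⊤; tt)
open import Function.Bundles using (Func; Inverse; _↔_)
import Function.Construct.Composition as Comp
import Function.Construct.Identity as Ident
import Function.Relation.Binary.Setoid.Equality as FuncEq
open import Level using (Level; Lift; lift; lower; _⊔_; 0ℓ) renaming (suc to lsuc)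
open import Relation.Binary.Bundles using (Setoid)
open import Relation.Binary.Structures using (IsEquivalence)
open import Relation.Binary.PropositionalEquality.Core as ≡
  using (_≡_; subst; subst₂)
import Relation.Binary.PropositionalEquality.Properties as ≡
open import Relation.Nullary using (Dec; yes; no; contradiction)

private
  variable
    o ℓ e o₁ ℓ₁ e₁ o₂ ℓ₂ e₂ o₃ ℓ₃ e₃ : Level

-- Hom-sets are setoids; sets of the informal mathematics are setoids
-- throughout.

record Category (o ℓ e : Level) : Set (lsuc (o ⊔ ℓ ⊔ e)) where
  infix  4 _≈_ _⇒_
  infixr 9 _∘_
  field
    Obj       : Set o
    _⇒_       : Obj → Obj → Set ℓ
    _≈_       : ∀ {A B} → A ⇒ B → A ⇒ B → Set e
    id        : ∀ {A} → A ⇒ A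
    _∘_       : ∀ {A B C} → B ⇒ C → A ⇒ B → A ⇒ C
    equiv     : ∀ {A B} → IsEquivalence (_≈_ {A} {B})
    assoc     : ∀ {A B C D} {f : A ⇒ B} {g : B ⇒ C} {h : C ⇒ D} →
                (h ∘ g) ∘ f ≈ h ∘ (g ∘ f)
    identityˡ : ∀ {A B} {f : A ⇒ B} → id ∘ f ≈ f
    identityʳ : ∀ {A B} {f : A ⇒ B} → f ∘ id ≈ f
    ∘-resp-≈  : ∀ {A B C} {f f′ : B ⇒ C} {g g′ : A ⇒ B} →
                f ≈ f′ → g ≈ g′ → f ∘ g ≈ f′ ∘ g′

  module Equiv {A B : Obj} = IsEquivalence (equiv {A} {B})
  open Equiv public

  homSetoid : Obj → Obj → Setoid ℓ e
  homSetoid A B = record { Carrier = A ⇒ B ; isEquivalence = equiv }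

  ∘-resp-≈ˡ : ∀ {A B C} {f f′ : B ⇒ C} {g : A ⇒ B} → f ≈ f′ → f ∘ g ≈ f′ ∘ g
  ∘-resp-≈ˡ p = ∘-resp-≈ p refl

  ∘-resp-≈ʳ : ∀ {A B C} {f : B ⇒ C} {g g′ : A ⇒ B} → g ≈ g′ → f ∘ g ≈ f ∘ g′
  ∘-resp-≈ʳ p = ∘-resp-≈ refl p

_[_,_] : (C : Category o ℓ e) → Category.Obj C → Category.Obj C → Set ℓ
C [ A , B ] = Category._⇒_ C A B

op : Category o ℓ e → Category o ℓ e
op C = record
  { Obj = Obj ; _⇒_ = λ A B → B ⇒ A ; _≈_ = _≈_ ; id = id ; _∘_ = λ f g → g ∘ f
  ; equiv = equiv ; assoc = sym assoc
  ; identityˡ = identityʳ ; identityʳ = identityˡ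
  ; ∘-resp-≈ = λ p q → ∘-resp-≈ q p }
  where open Category C

record Functor (C : Category o₁ ℓ₁ e₁) (D : Category o₂ ℓ₂ e₂) :
               Set (o₁ ⊔ ℓ₁ ⊔ e₁ ⊔ o₂ ⊔ ℓ₂ ⊔ e₂) where
  private
    module C = Category C
    module D = Category D
  field
    F₀           : C.Obj → D.Obj
    F₁           : ∀ {A B} → A C.⇒ B → F₀ A D.⇒ F₀ B
    identity     : ∀ {A} → F₁ (C.id {A}) D.≈ D.id
    homomorphism : ∀ {X Y Z} {f : X C.⇒ Y} {g : Y C.⇒ Z} →
                   F₁ (g C.∘ f) D.≈ F₁ g D.∘ F₁ f
    F-resp-≈     : ∀ {A B} {f g : A C.⇒ B} → f C.≈ g → F₁ f D.≈ F₁ g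

idF : {C : Category o ℓ e} → Functor C C
idF {C = C} = record
  { F₀ = λ X → X ; F₁ = λ f → f ; identity = C.refl ; homomorphism = C.refl
  ; F-resp-≈ = λ p → p }
  where module C = Category C

infixr 9 _∘F_
_∘F_ : {C : Category o₁ ℓ₁ e₁} {D : Category o₂ ℓ₂ e₂} {E : Category o₃ ℓ₃ e₃} →
       Functor D E → Functor C D → Functor C E
_∘F_ {E = E} G F = record
  { F₀ = λ X → G.F₀ (F.F₀ X) ; F₁ = λ f → G.F₁ (F.F₁ f)
  ; identity = E.trans (G.F-resp-≈ F.identity) G.identity
  ; homomorphism = E.trans (G.F-resp-≈ F.homomorphism) G.homomorphism
  ; F-resp-≈ = λ p → G.F-resp-≈ (F.F-resp-≈ p) }
  where
    module F = Functor F
    module G = Functor G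
    module E = Category E

opF : {C : Category o₁ ℓ₁ e₁} {D : Category o₂ ℓ₂ e₂} →
      Functor C D → Functor (op C) (op D)
opF F = record
  { F₀ = F₀ ; F₁ = F₁ ; identity = identity ; homomorphism = homomorphism
  ; F-resp-≈ = F-resp-≈ }
  where open Functor F

-- Strict equality of functors: on objects up to ≡, on morphisms up to
-- the equality of the target hom-setoid after transport.
record _≡F_ {C : Category o₁ ℓ₁ e₁} {D : Category o₂ ℓ₂ e₂} (F G : Functor C D) :
            Set (o₁ ⊔ ℓ₁ ⊔ e₁ ⊔ o₂ ⊔ ℓ₂ ⊔ e₂) where
  private
    module C = Category C
    module D = Category D
    module F = Functor F
    module G = Functor G
  field
    eq₀ : ∀ X → F.F₀ X ≡ G.F₀ X
    eq₁ : ∀ {X Y} (f : X C.⇒ Y) →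
          subst₂ D._⇒_ (eq₀ X) (eq₀ Y) (F.F₁ f) D.≈ G.F₁ f

record NaturalTransformation {C : Category o₁ ℓ₁ e₁} {D : Category o₂ ℓ₂ e₂}
                             (F G : Functor C D) :
                             Set (o₁ ⊔ ℓ₁ ⊔ ℓ₂ ⊔ e₂) where
  private
    module C = Category C
    module D = Category D
    module F = Functor F
    module G = Functor G
  field
    η       : ∀ X → F.F₀ X D.⇒ G.F₀ X
    commute : ∀ {X Y} (f : X C.⇒ Y) → η Y D.∘ F.F₁ f D.≈ G.F₁ f D.∘ η X

Functors : Category o₁ ℓ₁ e₁ → Category o₂ ℓ₂ e₂ →
           Category (o₁ ⊔ ℓ₁ ⊔ e₁ ⊔ o₂ ⊔ ℓ₂ ⊔ e₂) (o₁ ⊔ ℓ₁ ⊔ ℓ₂ ⊔ e₂) (o₁ ⊔ e₂)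
Functors C D = record
  { Obj = Functor C D
  ; _⇒_ = NaturalTransformation
  ; _≈_ = λ α β → ∀ X → η α X D.≈ η β X
  ; id = record
      { η = λ _ → D.id
      ; commute = λ _ → D.trans D.identityˡ (D.sym D.identityʳ) }
  ; _∘_ = λ α β → record
      { η = λ X → η α X D.∘ η β X
      ; commute = λ f →
          D.trans D.assoc
          (D.trans (D.∘-resp-≈ʳ (commute β f))
          (D.trans (D.sym D.assoc)
          (D.trans (D.∘-resp-≈ˡ (commute α f)) D.assoc))) }
  ; equiv = record
      { refl = λ _ → D.refl ; sym = λ p X → D.sym (p X)
      ; trans = λ p q X → D.trans (p X) (q X) }
  ; assoc = λ _ → D.assoc
  ; identityˡ = λ _ → D.identityˡ
  ; identityʳ = λ _ → D.identityʳ
  ; ∘-resp-≈ = λ p q X → D.∘-resp-≈ (p X) (q X) }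
  where
    module D = Category D
    open NaturalTransformation

Setoids : ∀ c ℓ → Category (lsuc (c ⊔ ℓ)) (c ⊔ ℓ) (c ⊔ ℓ)
Setoids c ℓ = record
  { Obj = Setoid c ℓ
  ; _⇒_ = Func
  ; _≈_ = λ {A} {B} f g → FuncEq._≈_ A B f g
  ; id = Ident.function _
  ; _∘_ = λ g f → Comp.function f g
  ; equiv = λ {A} {B} → FuncEq.isEquivalence A B
  ; assoc = λ {_} {_} {_} {D} _ → Setoid.refl D
  ; identityˡ = λ {_} {B} _ → Setoid.refl B
  ; identityʳ = λ {_} {B} _ → Setoid.refl B
  ; ∘-resp-≈ = λ {_} {_} {C} {_} {f′} {g} p q x →
      Setoid.trans C (p (Func.to g x)) (Func.cong f′ (q x)) }

module _ (C : Category o ℓ e) where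
  open Category C

  record _≅_ (A B : Obj) : Set (ℓ ⊔ e) where
    field
      from : A ⇒ B
      to   : B ⇒ A
      isoˡ : to ∘ from ≈ id
      isoʳ : from ∘ to ≈ id

  Mono : ∀ {A B} → A ⇒ B → Set (o ⊔ ℓ ⊔ e)
  Mono {A} f = ∀ {X} (g h : X ⇒ A) → f ∘ g ≈ f ∘ h → g ≈ h

  record Terminal : Set (o ⊔ ℓ ⊔ e) where
    field
      𝟏        : Obj
      !        : ∀ {A} → A ⇒ 𝟏
      !-unique : ∀ {A} (f : A ⇒ 𝟏) → ! ≈ f

  record Product (A B : Obj) : Set (o ⊔ ℓ ⊔ e) where
    field
      A×B      : Obj
      π₁       : A×B ⇒ A
      π₂       : A×B ⇒ B
      ⟨_,_⟩    : ∀ {X} → X ⇒ A → X ⇒ B → X ⇒ A×B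
      project₁ : ∀ {X} {f : X ⇒ A} {g : X ⇒ B} → π₁ ∘ ⟨ f , g ⟩ ≈ f
      project₂ : ∀ {X} {f : X ⇒ A} {g : X ⇒ B} → π₂ ∘ ⟨ f , g ⟩ ≈ g
      unique   : ∀ {X} {f : X ⇒ A} {g : X ⇒ B} {h : X ⇒ A×B} →
                 π₁ ∘ h ≈ f → π₂ ∘ h ≈ g → ⟨ f , g ⟩ ≈ h

  record Pullback {A B X : Obj} (f : A ⇒ X) (g : B ⇒ X) : Set (o ⊔ ℓ ⊔ e) where
    field
      P         : Obj
      p₁        : P ⇒ A
      p₂        : P ⇒ B
      commute   : f ∘ p₁ ≈ g ∘ p₂
      universal : ∀ {Q} {h₁ : Q ⇒ A} {h₂ : Q ⇒ B} → f ∘ h₁ ≈ g ∘ h₂ → Q ⇒ P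
      p₁∘universal≈h₁ : ∀ {Q} {h₁ : Q ⇒ A} {h₂ : Q ⇒ B} {eq : f ∘ h₁ ≈ g ∘ h₂} →
                        p₁ ∘ universal eq ≈ h₁
      p₂∘universal≈h₂ : ∀ {Q} {h₁ : Q ⇒ A} {h₂ : Q ⇒ B} {eq : f ∘ h₁ ≈ g ∘ h₂} →
                        p₂ ∘ universal eq ≈ h₂
      unique    : ∀ {Q} {h₁ : Q ⇒ A} {h₂ : Q ⇒ B} {eq : f ∘ h₁ ≈ g ∘ h₂} {u : Q ⇒ P} →
                  p₁ ∘ u ≈ h₁ → p₂ ∘ u ≈ h₂ → u ≈ universal eq

record Cone {J : Category o₁ ℓ₁ e₁} {C : Category o₂ ℓ₂ e₂} (D : Functor J C) :
            Set (o₁ ⊔ ℓ₁ ⊔ e₁ ⊔ o₂ ⊔ ℓ₂ ⊔ e₂) where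
  private
    module J = Category J
    module C = Category C
    module D = Functor D
  field
    N       : C.Obj
    ψ       : ∀ j → N C.⇒ D.F₀ j
    commute : ∀ {i j} (f : i J.⇒ j) → D.F₁ f C.∘ ψ i C.≈ ψ j

record IsLimit {J : Category o₁ ℓ₁ e₁} {C : Category o₂ ℓ₂ e₂} {D : Functor J C}
               (K : Cone D) : Set (o₁ ⊔ ℓ₁ ⊔ e₁ ⊔ o₂ ⊔ ℓ₂ ⊔ e₂) where
  private
    module C = Category C
  open Cone
  field
    rep      : (K′ : Cone D) → N K′ C.⇒ N K
    rep-comm : (K′ : Cone D) → ∀ j → ψ K j C.∘ rep K′ C.≈ ψ K′ j
    rep-uniq : (K′ : Cone D) (u : N K′ C.⇒ N K) →
               (∀ j → ψ K j C.∘ u C.≈ ψ K′ j) → rep K′ C.≈ u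

record Limit {J : Category o₁ ℓ₁ e₁} {C : Category o₂ ℓ₂ e₂} (D : Functor J C) :
             Set (o₁ ⊔ ℓ₁ ⊔ e₁ ⊔ o₂ ⊔ ℓ₂ ⊔ e₂) where
  field
    cone    : Cone D
    isLimit : IsLimit cone

mapCone : {J : Category o₁ ℓ₁ e₁} {C : Category o₂ ℓ₂ e₂} {E : Category o₃ ℓ₃ e₃}
          (F : Functor C E) {D : Functor J C} → Cone D → Cone (F ∘F D)
mapCone {E = E} F K = record
  { N = F.F₀ N ; ψ = λ j → F.F₁ (ψ j)
  ; commute = λ f → E.trans (E.sym F.homomorphism) (F.F-resp-≈ (commute f)) }
  where
    module F = Functor F
    module E = Category E
    open Cone K

-- Every limit cone existing in C, for a diagram of any shape J at the
-- given levels, is sent to a limit cone.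
PreservesLimits : ∀ oⱼ ℓⱼ eⱼ {C : Category o₁ ℓ₁ e₁} {E : Category o₂ ℓ₂ e₂} →
                  Functor C E →
                  Set (o₁ ⊔ ℓ₁ ⊔ e₁ ⊔ o₂ ⊔ ℓ₂ ⊔ e₂ ⊔ lsuc (oⱼ ⊔ ℓⱼ ⊔ eⱼ))
PreservesLimits oⱼ ℓⱼ eⱼ {C} F =
  (J : Category oⱼ ℓⱼ eⱼ) (D : Functor J C) (K : Cone D) →
  IsLimit K → IsLimit (mapCone F K)

record FiniteCategory (J : Category o ℓ e) : Set (o ⊔ ℓ ⊔ e) where
  open Category J
  field
    #Obj   : ℕ
    enum   : Obj ↔ Fin #Obj
    #Hom   : Obj → Obj → ℕ
    enumₕ  : ∀ A B → Inverse (homSetoid A B) (≡.setoid (Fin (#Hom A B)))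

FinitelyComplete : Category o ℓ e → Set (lsuc 0ℓ ⊔ o ⊔ ℓ ⊔ e)
FinitelyComplete C =
  (J : Category 0ℓ 0ℓ 0ℓ) → FiniteCategory J → (D : Functor J C) → Limit D

-- A preorder on Fin n as a category with at most one morphism between
-- any two objects.
module _ {n : ℕ} (_⟶_ : Fin n → Fin n → Set)
         (rfl : ∀ {i} → i ⟶ i) (trn : ∀ {i j k} → j ⟶ k → i ⟶ j → i ⟶ k) where

  thin : Category 0ℓ 0ℓ 0ℓ
  thin = record
    { Obj = Fin n ; _⇒_ = _⟶_ ; _≈_ = λ _ _ → ⊤ ; id = rfl ; _∘_ = trn }

  thin-finite : (∀ i j → Dec (i ⟶ j)) → FiniteCategory thin
  thin-finite dec = record
    { #Obj = n ; enum = Ident.↔-id _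
    ; #Hom = λ i j → size (dec i j) ; enumₕ = λ i j → listing (dec i j) }
    where
      size : ∀ {i j} → Dec (i ⟶ j) → ℕ
      size (yes _) = 1
      size (no _)  = 0

      listing : ∀ {i j} (d : Dec (i ⟶ j)) →
                Inverse (Category.homSetoid thin i j) (≡.setoid (Fin (size d)))
      listing (yes p) = record
        { to = λ _ → zero ; from = λ _ → p
        ; to-cong = λ _ → ≡.refl ; from-cong = λ _ → tt
        ; inverse = (λ { {zero} _ → ≡.refl }) , (λ _ → tt) }
      listing (no ¬p) = record
        { to = λ q → contradiction q ¬p ; from = λ ()
        ; to-cong = λ {q} _ → contradiction q ¬p ; from-cong = λ _ → tt
        ; inverse = (λ { {()} }) , (λ _ → tt) }

discrete : ℕ → Category 0ℓ 0ℓ 0ℓ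
discrete n = thin {n} _≡_ ≡.refl (λ p q → ≡.trans q p)

discrete-finite : ∀ n → FiniteCategory (discrete n)
discrete-finite n = thin-finite _≡_ ≡.refl (λ p q → ≡.trans q p) Fin._≟_

-- The shape 0 → 2 ← 1.
data Cospan : Fin 3 → Fin 3 → Set where
  idn : ∀ {i} → Cospan i i
  l   : Cospan 0F 2F
  r   : Cospan 1F 2F

cospan-trans : ∀ {i j k} → Cospan j k → Cospan i j → Cospan i k
cospan-trans idn q = q
cospan-trans l idn = l
cospan-trans r idn = r

cospan : Category 0ℓ 0ℓ 0ℓ
cospan = thin Cospan idn cospan-trans

cospan-finite : FiniteCategory cospan
cospan-finite = thin-finite Cospan idn cospan-trans dec
  where
    dec : ∀ i j → Dec (Cospan i j)
    dec 0F 0F = yes idn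
    dec 0F 1F = no λ ()
    dec 0F 2F = yes l
    dec 1F 0F = no λ ()
    dec 1F 1F = yes idn
    dec 1F 2F = yes r
    dec 2F 0F = no λ ()
    dec 2F 1F = no λ ()
    dec 2F 2F = yes idn

module FiniteLimits {C : Category o ℓ e} (fc : FinitelyComplete C) where
  open Category C

  private
    discreteDiagram : ∀ {n} → (Fin n → Obj) → Functor (discrete n) C
    discreteDiagram X = record
      { F₀ = X ; F₁ = λ { ≡.refl → id } ; identity = refl
      ; homomorphism = λ { {f = ≡.refl} {≡.refl} → sym identityˡ }
      ; F-resp-≈ = λ { {f = ≡.refl} {≡.refl} _ → refl } }

    discreteCone : ∀ {n} {X : Fin n → Obj} (Q : Obj) → (∀ i → Q ⇒ X i) →
                   Cone (discreteDiagram X)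
    discreteCone Q p = record
      { N = Q ; ψ = p ; commute = λ { ≡.refl → identityˡ } }

  -- Only the universal properties matter; abstract keeps conversion
  -- checking from unfolding the chosen limits.
  abstract
    terminal : Terminal C
    terminal = record
      { 𝟏 = Cone.N cone
      ; ! = λ {A} → rep (discreteCone A λ ())
      ; !-unique = λ {A} f → rep-uniq (discreteCone A λ ()) f λ () }
      where
        open Limit (fc (discrete 0) (discrete-finite 0) (discreteDiagram λ ()))
        open IsLimit isLimit

    product : ∀ A B → Product C A B
    product A B = record
      { A×B = Cone.N cone ; π₁ = Cone.ψ cone 0F ; π₂ = Cone.ψ cone 1F
      ; ⟨_,_⟩ = λ f g → rep (pairCone f g)
      ; project₁ = λ {_} {f} {g} → rep-comm (pairCone f g) 0F
      ; project₂ = λ {_} {f} {g} → rep-comm (pairCone f g) 1F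
      ; unique = λ {_} {f} {g} {h} p q →
          rep-uniq (pairCone f g) h λ { 0F → p ; 1F → q } }
      where
        pair : Fin 2 → Obj
        pair 0F = A
        pair 1F = B

        open Limit (fc (discrete 2) (discrete-finite 2) (discreteDiagram pair))
        open IsLimit isLimit

        pairCone : ∀ {X} → X ⇒ A → X ⇒ B → Cone (discreteDiagram pair)
        pairCone {X} f g = discreteCone X λ { 0F → f ; 1F → g }

    pullback : ∀ {A B X} (f : A ⇒ X) (g : B ⇒ X) → Pullback C f g
    pullback {A} {B} {X} f g = record
      { P = Cone.N cone ; p₁ = ψ 0F ; p₂ = ψ 1F
      ; commute = trans (commute l) (sym (commute r))
      ; universal = λ eq → rep (squareCone eq)
      ; p₁∘universal≈h₁ = λ {_} {_} {_} {eq} → rep-comm (squareCone eq) 0F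
      ; p₂∘universal≈h₂ = λ {_} {_} {_} {eq} → rep-comm (squareCone eq) 1F
      ; unique = λ {_} {_} {_} {eq} {u} p q → sym (rep-uniq (squareCone eq) u
          λ { 0F → p
            ; 1F → q
            ; 2F → trans (∘-resp-≈ˡ (sym (commute l))) (trans assoc (∘-resp-≈ʳ p)) }) }
      where
        vertex : Fin 3 → Obj
        vertex 0F = A
        vertex 1F = B
        vertex 2F = X

        edge : ∀ {i j} → Cospan i j → vertex i ⇒ vertex j
        edge idn = id
        edge l   = f
        edge r   = g

        homomorphism : ∀ {i j k} (p : Cospan i j) (q : Cospan j k) →
                       edge (cospan-trans q p) ≈ edge q ∘ edge p
        homomorphism p idn = sym identityˡ
        homomorphism idn l = sym identityʳ
        homomorphism idn r = sym identityʳ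

        resp : ∀ {i j} (p q : Cospan i j) → edge p ≈ edge q
        resp idn idn = refl
        resp l l = refl
        resp r r = refl

        diagram : Functor cospan C
        diagram = record
          { F₀ = vertex ; F₁ = edge ; identity = refl
          ; homomorphism = λ {_} {_} {_} {p} {q} → homomorphism p q
          ; F-resp-≈ = λ {_} {_} {p} {q} _ → resp p q }

        open Limit (fc cospan cospan-finite diagram)
        open IsLimit isLimit
        open Cone cone using (ψ; commute)

        squareCone : ∀ {Q} {h₁ : Q ⇒ A} {h₂ : Q ⇒ B} → f ∘ h₁ ≈ g ∘ h₂ → Cone diagram
        squareCone {Q} {h₁} {h₂} eq = record
          { N = Q
          ; ψ = λ { 0F → h₁ ; 1F → h₂ ; 2F → f ∘ h₁ }
          ; commute = λ { idn → identityˡ ; l → refl ; r → sym eq } }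

  -×_ : Obj → Functor C C
  -× b = record
    { F₀ = λ a → A×B (product a b)
    ; F₁ = λ {a} {a′} f → map f
    ; identity = λ {a} → unique (product a b)
        (trans identityʳ (sym identityˡ)) identityʳ
    ; homomorphism = λ {a} {a′} {a″} {f} {g} → unique (product a″ b)
        (trans (sym assoc)
          (trans (∘-resp-≈ˡ (project₁ (product a″ b)))
          (trans assoc
          (trans (∘-resp-≈ʳ (project₁ (product a′ b))) (sym assoc)))))
        (trans (sym assoc)
          (trans (∘-resp-≈ˡ (project₂ (product a″ b))) (project₂ (product a′ b))))
    ; F-resp-≈ = λ {a} {a′} p → unique (product a′ b)
        (trans (project₁ (product a′ b)) (∘-resp-≈ˡ (sym p)))
        (project₂ (product a′ b)) }
    where
      open Product
      map : ∀ {a a′} → a ⇒ a′ → A×B (product a b) ⇒ A×B (product a′ b)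
      map {a} {a′} f = ⟨_,_⟩ (product a′ b) (f ∘ π₁ (product a b)) (π₂ (product a b))

-- Presheaves take values in setoids at a level large enough to hold
-- both the hom-setoids and the setoids of subobjects of C.
module _ (C : Category o ℓ e) where

  Psh : Category (lsuc (o ⊔ ℓ ⊔ e)) (o ⊔ ℓ ⊔ e) (o ⊔ ℓ ⊔ e)
  Psh = Functors (op C) (Setoids (o ⊔ ℓ ⊔ e) (o ⊔ ℓ ⊔ e))

  Presheaf : Set (lsuc (o ⊔ ℓ ⊔ e))
  Presheaf = Category.Obj Psh

module _ {C : Category o ℓ e} where
  open Category C

  y : Obj → Presheaf C
  y c = record
    { F₀ = λ X → record
        { Carrier = Lift (o ⊔ ℓ ⊔ e) (X ⇒ c)
        ; _≈_ = λ f g → Lift (o ⊔ ℓ ⊔ e) (lower f ≈ lower g)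
        ; isEquivalence = record
            { refl = lift refl ; sym = λ p → lift (sym (lower p))
            ; trans = λ p q → lift (trans (lower p) (lower q)) } }
    ; F₁ = λ f → record
        { to = λ g → lift (lower g ∘ f)
        ; cong = λ p → lift (∘-resp-≈ˡ (lower p)) }
    ; identity = λ _ → lift identityʳ
    ; homomorphism = λ _ → lift (sym assoc)
    ; F-resp-≈ = λ p _ → lift (∘-resp-≈ʳ p) }

  Representable : Presheaf C → Set (o ⊔ ℓ ⊔ e)
  Representable P = Σ[ c ∈ Obj ] _≅_ (Psh C) (y c) P

-- Limits in op C are colimits in C.
IsVirtual : ∀ oⱼ ℓⱼ eⱼ {C : Category o ℓ e} → Presheaf C →
            Set (lsuc (o ⊔ ℓ ⊔ e ⊔ oⱼ ⊔ ℓⱼ ⊔ eⱼ))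
IsVirtual oⱼ ℓⱼ eⱼ P = PreservesLimits oⱼ ℓⱼ eⱼ P

module Subobjects {C : Category o ℓ e} (fc : FinitelyComplete C) where
  open Category C
  open FiniteLimits fc

  record Subobject (X : Obj) : Set (o ⊔ ℓ ⊔ e) where
    field
      dom   : Obj
      arrow : dom ⇒ X
      mono  : Mono C arrow
  open Subobject

  Factors : ∀ {Q X} → Q ⇒ X → Subobject X → Set (ℓ ⊔ e)
  Factors h m = Σ[ k ∈ _ ⇒ dom m ] arrow m ∘ k ≈ h

  -- Monomorphisms into X represent the same subobject when each
  -- factors through the other.
  record _≈ₛ_ {X} (m n : Subobject X) : Set (o ⊔ ℓ ⊔ e) where
    field
      ≤ : Factors (arrow m) n
      ≥ : Factors (arrow n) m
  open _≈ₛ_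

  factors-resp : ∀ {Q X} {h h′ : Q ⇒ X} (m : Subobject X) →
                 h ≈ h′ → Factors h m → Factors h′ m
  factors-resp m p (k , q) = k , trans q p

  factors-∘ : ∀ {Q R X} {h : Q ⇒ X} (m : Subobject X) →
              Factors h m → (u : R ⇒ Q) → Factors (h ∘ u) m
  factors-∘ m (k , q) u = k ∘ u , trans (sym assoc) (∘-resp-≈ˡ q)

  factors-≤ : ∀ {Q X} {h : Q ⇒ X} (m n : Subobject X) →
              Factors (arrow m) n → Factors h m → Factors h n
  factors-≤ m n p (k , q) = factors-resp n q (factors-∘ n p k)

  factors-self : ∀ {X} (m : Subobject X) → Factors (arrow m) m
  factors-self m = id , identityʳ

  subobjects : Obj → Setoid (o ⊔ ℓ ⊔ e) (o ⊔ ℓ ⊔ e)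
  subobjects X = record
    { Carrier = Subobject X
    ; _≈_ = _≈ₛ_
    ; isEquivalence = record
        { refl = λ {m} → record { ≤ = factors-self m ; ≥ = factors-self m }
        ; sym = λ p → record { ≤ = ≥ p ; ≥ = ≤ p }
        ; trans = λ {m} {n} {k} p q → record
            { ≤ = factors-≤ n k (≤ q) (≤ p) ; ≥ = factors-≤ n m (≥ p) (≥ q) } } }

  infixr 9 _*_
  _*_ : ∀ {X Y} → X ⇒ Y → Subobject Y → Subobject X
  f * m = record
    { dom = P ; arrow = p₁
    ; mono = λ g h p →
        trans (unique {eq = square h} p
                (mono m _ _
                  (trans (sym assoc)
                  (trans (∘-resp-≈ˡ (sym commute))
                  (trans assoc
                  (trans (∘-resp-≈ʳ p) (square h)))))))
              (sym (unique refl refl)) }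
    where
      open Pullback (pullback f (arrow m))
      square : ∀ {Q} (h : Q ⇒ P) → f ∘ (p₁ ∘ h) ≈ arrow m ∘ (p₂ ∘ h)
      square h = trans (sym assoc) (trans (∘-resp-≈ˡ commute) assoc)

  abstract
    *-intro : ∀ {Q X Y} {h : Q ⇒ X} (f : X ⇒ Y) (m : Subobject Y) →
              Factors (f ∘ h) m → Factors h (f * m)
    *-intro f m (k , q) = universal (sym q) , p₁∘universal≈h₁
      where open Pullback (pullback f (arrow m))

    *-elim : ∀ {Q X Y} {h : Q ⇒ X} (f : X ⇒ Y) (m : Subobject Y) →
             Factors h (f * m) → Factors (f ∘ h) m
    *-elim f m (k , q) =
      p₂ ∘ k ,
      trans (sym assoc) (trans (∘-resp-≈ˡ (sym commute)) (trans assoc (∘-resp-≈ʳ q)))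
      where open Pullback (pullback f (arrow m))

    *-≤ : ∀ {X Y} {f g : X ⇒ Y} (m n : Subobject Y) → f ≈ g →
          Factors (arrow m) n → Factors (arrow (f * m)) (g * n)
    *-≤ {f = f} {g} m n p q =
      *-intro g n (factors-resp n (∘-resp-≈ˡ p)
        (factors-≤ m n q (*-elim f m (factors-self (f * m)))))

  Sub : Presheaf C
  Sub = record
    { F₀ = subobjects
    ; F₁ = λ f → record
        { to = f *_
        ; cong = λ {m} {n} p → record
            { ≤ = *-≤ m n refl (≤ p) ; ≥ = *-≤ n m refl (≥ p) } }
    ; identity = λ m → record
        { ≤ = factors-resp m identityˡ (*-elim id m (factors-self (id * m)))
        ; ≥ = *-intro id m (factors-resp m (sym identityˡ) (factors-self m)) }
    ; homomorphism = λ {_} {_} {_} {f} {g} m → record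
        { ≤ = *-intro g (f * m) (*-intro f m (factors-resp m assoc
                (*-elim (f ∘ g) m (factors-self ((f ∘ g) * m)))))
        ; ≥ = *-intro (f ∘ g) m (factors-resp m (sym assoc)
                (*-elim f m (*-elim g (f * m) (factors-self (g * f * m))))) }
    ; F-resp-≈ = λ p m → record
        { ≤ = *-≤ m m p (factors-self m) ; ≥ = *-≤ m m (sym p) (factors-self m) } }

  maximal : ∀ X → Subobject X
  maximal X = record
    { dom = X ; arrow = id
    ; mono = λ g h p → trans (sym identityˡ) (trans p identityˡ) }

  -- The presheaf 1 is taken to be the represented one, y 𝟏.
  ⊤ₛ : Psh C [ y (Terminal.𝟏 terminal) , Sub ]
  ⊤ₛ = record
    { η = λ X → record
        { to = λ _ → maximal X
        ; cong = λ _ → Setoid.refl (subobjects X) }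
    ; commute = λ {X} {Y} f _ → record
        { ≤ = *-intro f (maximal X) (f ∘ id , identityˡ)
        ; ≥ = arrow (f * maximal X) , identityˡ } }

-- Virtual objects preserve the existing limits of all shapes J at levels
-- oⱼ ℓⱼ eⱼ.
record PredicativeTopos (oⱼ ℓⱼ eⱼ : Level) (C : Category o ℓ e) :
                        Set (lsuc (o ⊔ ℓ ⊔ e ⊔ oⱼ ⊔ ℓⱼ ⊔ eⱼ)) where
  open Category C using (Obj)
  field
    finitelyComplete : FinitelyComplete C

  open FiniteLimits finitelyComplete public
  open Subobjects finitelyComplete public

  field
    exponential-virtual : ∀ (b c : Obj) → IsVirtual oⱼ ℓⱼ eⱼ (y c ∘F opF (-× b))
    virtual-subobject-representable :
      ∀ (c : Obj) (P : Presheaf C) (m : Psh C [ P , y c ]) →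
      Mono (Psh C) m → IsVirtual oⱼ ℓⱼ eⱼ P → Representable P
    Sub-virtual : IsVirtual oⱼ ℓⱼ eⱼ Sub

-- Grothendieck construction of a presheaf.  ∫ (y X) is the slice of C
-- over X.
module _ {C : Category o ℓ e} where
  open Category C

  module _ (P : Presheaf C) where
    private
      module P = Functor P
      module PX (X : Obj) = Setoid (P.F₀ X)

    record Element : Set (o ⊔ ℓ ⊔ e) where
      constructor _,ₑ_
      field
        base : Obj
        elem : PX.Carrier base
    open Element

    record ElementHom (A B : Element) : Set (o ⊔ ℓ ⊔ e) where
      constructor _,ₕ_
      field
        hom  : base A ⇒ base B
        over : PX._≈_ (base A) (Func.to (P.F₁ hom) (elem B)) (elem A)
    open ElementHom

    ∫ : Category (o ⊔ ℓ ⊔ e) (o ⊔ ℓ ⊔ e) e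
    ∫ = record
      { Obj = Element
      ; _⇒_ = ElementHom
      ; _≈_ = λ f g → hom f ≈ hom g
      ; id = λ {A} → id ,ₕ P.identity (elem A)
      ; _∘_ = λ {A} {B} {D} f g → (hom f ∘ hom g) ,ₕ
          PX.trans (base A) (P.homomorphism (elem D))
            (PX.trans (base A) (Func.cong (P.F₁ (hom g)) (over f)) (over g))
      ; equiv = record { refl = refl ; sym = sym ; trans = trans }
      ; assoc = assoc ; identityˡ = identityˡ ; identityʳ = identityʳ
      ; ∘-resp-≈ = ∘-resp-≈ }

    ∫-proj : Functor ∫ C
    ∫-proj = record
      { F₀ = base ; F₁ = hom ; identity = refl ; homomorphism = refl
      ; F-resp-≈ = λ p → p }

  ∫-map : (P Q : Presheaf C) → Psh C [ P , Q ] → Functor (∫ P) (∫ Q)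
  ∫-map P Q α = record
    { F₀ = λ { (X ,ₑ a) → X ,ₑ Func.to (η X) a }
    ; F₁ = λ { {X ,ₑ a} {Y ,ₑ b} (f ,ₕ p) → f ,ₕ
        Setoid.trans (Functor.F₀ Q X)
          (Setoid.sym (Functor.F₀ Q X) (commute f b))
          (Func.cong (η X) p) }
    ; identity = refl ; homomorphism = refl ; F-resp-≈ = λ p → p }
    where open NaturalTransformation α

module _ {oₑ ℓₑ eₑ : Level} {E : Category oₑ ℓₑ eₑ} {B : Category o ℓ e} (p : Functor E B) where
  private
    module E = Category E
    module B = Category B
    module p = Functor p

  record Cartesian {x′ x : E.Obj} (f : x′ E.⇒ x) : Set (oₑ ⊔ ℓₑ ⊔ eₑ ⊔ ℓ ⊔ e) where
    field
      factor  : ∀ {z} (g : z E.⇒ x) (w : p.F₀ z B.⇒ p.F₀ x′) →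
                p.F₁ f B.∘ w B.≈ p.F₁ g → z E.⇒ x′
      factor-over : ∀ {z} (g : z E.⇒ x) (w : p.F₀ z B.⇒ p.F₀ x′)
                    (eq : p.F₁ f B.∘ w B.≈ p.F₁ g) → p.F₁ (factor g w eq) B.≈ w
      factor-comm : ∀ {z} (g : z E.⇒ x) (w : p.F₀ z B.⇒ p.F₀ x′)
                    (eq : p.F₁ f B.∘ w B.≈ p.F₁ g) → f E.∘ factor g w eq E.≈ g
      factor-uniq : ∀ {z} (g : z E.⇒ x) (w : p.F₀ z B.⇒ p.F₀ x′)
                    (eq : p.F₁ f B.∘ w B.≈ p.F₁ g) (h : z E.⇒ x′) →
                    p.F₁ h B.≈ w → f E.∘ h E.≈ g → h E.≈ factor g w eq

  record CartesianLift {b : B.Obj} (x : E.Obj) (f : b B.⇒ p.F₀ x) :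
                       Set (oₑ ⊔ ℓₑ ⊔ eₑ ⊔ o ⊔ ℓ ⊔ e) where
    field
      x′        : E.Obj
      x′-over   : p.F₀ x′ ≡ b
      f′        : x′ E.⇒ x
      f′-over   : subst (B._⇒ p.F₀ x) x′-over (p.F₁ f′) B.≈ f
      cartesian : Cartesian f′

  IsFibration : Set (oₑ ⊔ ℓₑ ⊔ eₑ ⊔ o ⊔ ℓ ⊔ e)
  IsFibration = ∀ {b} (x : E.Obj) (f : b B.⇒ p.F₀ x) → CartesianLift x f

record _⊣_ {C : Category o₁ ℓ₁ e₁} {D : Category o₂ ℓ₂ e₂}
           (L : Functor C D) (R : Functor D C) :
           Set (o₁ ⊔ ℓ₁ ⊔ e₁ ⊔ o₂ ⊔ ℓ₂ ⊔ e₂) where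
  private
    module C = Category C
    module D = Category D
    module L = Functor L
    module R = Functor R
  field
    unit   : NaturalTransformation idF (R ∘F L)
    counit : NaturalTransformation (L ∘F R) idF
  module unit   = NaturalTransformation unit
  module counit = NaturalTransformation counit
  field
    zig : ∀ X → counit.η (L.F₀ X) D.∘ L.F₁ (unit.η X) D.≈ D.id
    zag : ∀ Y → R.F₁ (counit.η Y) C.∘ unit.η (R.F₀ Y) C.≈ C.id

record IsPlainDTT {o₁ ℓ₁ e₁ o₂ ℓ₂ e₂ o₃ ℓ₃ e₃ : Level}
                  {ctx : Category o₁ ℓ₁ e₁}
                  {𝒰 : Category o₂ ℓ₂ e₂} {𝒰̇ : Category o₃ ℓ₃ e₃}
                  (u : Functor 𝒰 ctx) (u̇ : Functor 𝒰̇ ctx)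
                  (S : Functor 𝒰̇ 𝒰) (Δ : Functor 𝒰 𝒰̇) (S⊣Δ : S ⊣ Δ) :
                  Set (o₁ ⊔ ℓ₁ ⊔ e₁ ⊔ o₂ ⊔ ℓ₂ ⊔ e₂ ⊔ o₃ ⊔ ℓ₃ ⊔ e₃) where
  private
    module 𝒰 = Category 𝒰
    module 𝒰̇ = Category 𝒰̇
  open _⊣_ S⊣Δ
  field
    ctx-terminal     : Terminal ctx
    u-fibration      : IsFibration u
    u̇-fibration      : IsFibration u̇
    u∘S≡u̇            : (u ∘F S) ≡F u̇
    S-cartesian      : ∀ {A B} (f : A 𝒰̇.⇒ B) → Cartesian u̇ f →
                       Cartesian u (Functor.F₁ S f)
    Δ-cartesian      : ∀ {A B} (f : A 𝒰.⇒ B) → Cartesian u f →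
                       Cartesian u̇ (Functor.F₁ Δ f)
    unit-cartesian   : ∀ A → Cartesian u̇ (unit.η A)
    counit-cartesian : ∀ A → Cartesian u (counit.η A)

{-# OPTIONS --safe #-}

-- A map f pulls the subobject m back to the maximal one exactly when f
-- factors through m.  Hence the domain of φ(id) represents the pullback of ⊤
-- along φ, and Δ⊤ takes a subobject to its domain, with counit the inclusion
-- and unit the identity.  All cartesianness conditions are automatic, since
-- every morphism of the Grothendieck construction of a presheaf of setoids is
-- cartesian.

module Submission where

open import Level using (Level; Lift; lift; lower)
open import Data.Product.Base using (Σ-syntax; _×_; _,_; proj₁; proj₂)
open import Function.Bundles using (Func)
open import Relation.Binary.Bundles using (Setoid)
open import Relation.Binary.PropositionalEquality.Core as ≡ using ()
open import Defs

private
  variable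
    o ℓ e : Level

module _ (C : Category o ℓ e) where
  open Category C

  ≅-refl : ∀ {A} → _≅_ C A A
  ≅-refl = record { from = id ; to = id ; isoˡ = identityˡ ; isoʳ = identityˡ }

module _ {C : Category o ℓ e} (P : Presheaf C) where
  open Category C
  open Element
  open ElementHom
  private
    module P = Functor P

  -- The factorization is `w` itself, since morphisms of `∫ P` are compared by `hom` alone. That `w`
  -- carries `elem A` to the element of `Z` follows by rewriting `elem A` as the restriction of
  -- `elem B` along `f`, then using functoriality and `over g`.
  ∫-cartesian : ∀ {A B} (f : Category._⇒_ (∫ P) A B) → Cartesian (∫-proj P) f
  ∫-cartesian {A} {B} f = record
    { factor = λ {Z} g w eq →
        let open Setoid (P.F₀ (base Z)) renaming (sym to symₚ; trans to transₚ)
        in w ,ₕ transₚ (Func.cong (P.F₁ w) (Setoid.sym (P.F₀ (base A)) (over f)))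
             (transₚ (symₚ (P.homomorphism (elem B)))
             (transₚ (P.F-resp-≈ eq (elem B)) (over g)))
    ; factor-over = λ _ _ _ → refl
    ; factor-comm = λ _ _ eq → eq
    ; factor-uniq = λ _ _ _ _ p _ → p }

  ∫-fibration : IsFibration (∫-proj P)
  ∫-fibration {b} (X ,ₑ a) f = record
    { x′ = b ,ₑ Func.to (P.F₁ f) a
    ; x′-over = ≡.refl
    ; f′ = lifted
    ; f′-over = refl
    ; cartesian = ∫-cartesian lifted }
    where
      lifted : ElementHom P (b ,ₑ Func.to (P.F₁ f) a) (X ,ₑ a)
      lifted = f ,ₕ Setoid.refl (P.F₀ b)

module _ {C : Category o ℓ e} (fc : FinitelyComplete C) where
  open Category C
  open FiniteLimits fc
  open Subobjects fc
  open Subobject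
  open _≈ₛ_
  open Terminal terminal
  open NaturalTransformation using (η) renaming (commute to natural)

  -- The content is in `≥`: the identity of `X` factors through the pullback as soon as `f` factors
  -- through `m`.
  factors⇒*-maximal : ∀ {X Y} {f : X ⇒ Y} (m : Subobject Y) →
                      Factors f m → (f * m) ≈ₛ maximal X
  factors⇒*-maximal {f = f} m k = record
    { ≤ = arrow (f * m) , identityˡ
    ; ≥ = *-intro f m (factors-resp m (sym identityʳ) k) }

  *-maximal⇒factors : ∀ {X Y} {f : X ⇒ Y} (m : Subobject Y) →
                      (f * m) ≈ₛ maximal X → Factors f m
  *-maximal⇒factors {f = f} m p =
    factors-resp m identityʳ (*-elim f m (≥ p))

  private
    y𝟏 : Presheaf C
    y𝟏 = y 𝟏

  module _ {Γ : Obj} (φ : Psh C [ y Γ , Sub ]) where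

    classified : Subobject Γ
    classified = Func.to (η φ Γ) (lift id)

    -- Naturality of `φ` along `h`, evaluated at the universal element `id`.
    yoneda-≈ : ∀ {X} (h : Lift _ (X ⇒ Γ)) →
               Func.to (η φ X) h ≈ₛ (lower h * classified)
    yoneda-≈ {X} h = Setoid.trans (subobjects X)
      (Func.cong (η φ X) (lift (sym identityˡ)))
      (natural φ (lower h) (lift id))

    -- Maps into the apex are built pointwise from factorizations through `classified`; its monicity
    -- makes them respect equality, natural and unique.
    ⊤-pullback : Pullback (Psh C) φ ⊤ₛ
    ⊤-pullback = record
      { P = y (dom classified)
      ; p₁ = record
          { η = λ X → record
              { to = λ k → lift (arrow classified ∘ lower k)
              ; cong = λ p → lift (∘-resp-≈ʳ (lower p)) }
          ; commute = λ _ _ → lift (sym assoc) }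
      ; p₂ = record
          { η = λ X → record
              { to = λ _ → lift !
              ; cong = λ _ → lift refl }
          ; commute = λ _ _ → lift (!-unique _) }
      ; commute = λ X k → Setoid.trans (subobjects X)
          (yoneda-≈ (lift (arrow classified ∘ lower k)))
          (factors⇒*-maximal classified (lower k , refl))
      ; universal = λ {Q} {h₁} {h₂} eq → record
          { η = λ X → record
              { to = λ q → lift (proj₁ (factor h₁ h₂ eq q))
              ; cong = λ {q} {q′} p → lift (mono classified _ _
                  (trans (proj₂ (factor h₁ h₂ eq q))
                  (trans (lower (Func.cong (η h₁ X) p))
                         (sym (proj₂ (factor h₁ h₂ eq q′)))))) }
          ; commute = λ {X} {Y} f q → lift (mono classified _ _
              (trans (proj₂ (factor h₁ h₂ eq _))
              (trans (lower (natural h₁ f q))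
              (trans (∘-resp-≈ˡ (sym (proj₂ (factor h₁ h₂ eq q)))) assoc)))) }
      ; p₁∘universal≈h₁ = λ {_} {h₁} {h₂} {eq} X q →
          lift (proj₂ (factor h₁ h₂ eq q))
      ; p₂∘universal≈h₂ = λ _ _ → lift (!-unique _)
      ; unique = λ {_} {h₁} {h₂} {eq} p _ X q → lift (mono classified _ _
          (trans (lower (p X q)) (sym (proj₂ (factor h₁ h₂ eq q))))) }
      where
        factor : ∀ {Q : Presheaf C} (h₁ : Psh C [ Q , y Γ ]) (h₂ : Psh C [ Q , y𝟏 ]) →
                 Category._≈_ (Psh C) (Category._∘_ (Psh C) φ h₁)
                                      (Category._∘_ (Psh C) ⊤ₛ h₂) →
                 ∀ {X} (q : Setoid.Carrier (Functor.F₀ Q X)) →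
                 Factors (lower (Func.to (η h₁ X) q)) classified
        -- The square at `q` says that `φ` sends `h₁ q` to the maximal subobject; by Yoneda,
        -- `classified` pulls back to it along `h₁ q`.
        factor h₁ h₂ eq {X} q = *-maximal⇒factors classified
          (Setoid.trans (subobjects X)
            (Setoid.sym (subobjects X) (yoneda-≈ (Func.to (η h₁ X) q)))
            (eq X q))

  private
    Σ⊤ : Functor (∫ y𝟏) (∫ Sub)
    Σ⊤ = ∫-map y𝟏 Sub ⊤ₛ

  open Element
  open ElementHom

  -- This gives the action of `Δ⊤` on morphisms: `over f` identifies `elem A` with the pullback of
  -- `elem B` along `hom f`. Since `arrow (elem B)` is mono, the factorization is unique, whence the
  -- functor laws.
  comprehension-factors : ∀ {A B} (f : ElementHom Sub A B) →
                          Factors (hom f ∘ arrow (elem A)) (elem B)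
  comprehension-factors {A} {B} f = *-elim (hom f) (elem B) (≥ (over f))

  Δ⊤ : Functor (∫ Sub) (∫ y𝟏)
  Δ⊤ = record
    { F₀ = λ A → dom (elem A) ,ₑ lift !
    ; F₁ = λ f → proj₁ (comprehension-factors f) ,ₕ lift (sym (!-unique _))
    ; identity = λ {A} → mono (elem A) _ _
        (trans (proj₂ (comprehension-factors (Category.id (∫ Sub) {A})))
        (trans identityˡ (sym identityʳ)))
    ; homomorphism = λ {A} {B} {D} {f} {g} → mono (elem D) _ _
        (trans (proj₂ (comprehension-factors (Category._∘_ (∫ Sub) g f)))
        (trans assoc
        (trans (∘-resp-≈ʳ (sym (proj₂ (comprehension-factors f))))
        (trans (sym assoc)
        (trans (∘-resp-≈ˡ (sym (proj₂ (comprehension-factors g)))) assoc)))))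
    ; F-resp-≈ = λ {A} {B} {f} {g} p → mono (elem B) _ _
        (trans (proj₂ (comprehension-factors f))
        (trans (∘-resp-≈ˡ p) (sym (proj₂ (comprehension-factors g))))) }

  Σ⊤⊣Δ⊤ : Σ⊤ ⊣ Δ⊤
  Σ⊤⊣Δ⊤ = record
    { unit = record
        -- A maximal subobject has the whole object as domain, so `id` serves; the two maps to `𝟏`
        -- agree by terminality.
        { η = λ A → id ,ₕ lift (trans (sym (!-unique _)) (!-unique _))
        ; commute = λ f → sym (trans identityʳ (trans (sym identityˡ)
            (trans (proj₂ (comprehension-factors (Functor.F₁ Σ⊤ f)))
            (trans identityʳ (sym identityˡ))))) }
    ; counit = record
        { η = inclusion
        -- Naturality of the inclusions is the very equation that defines `Δ⊤` on morphisms.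
        ; commute = λ f → proj₂ (comprehension-factors f) }
    ; zig = λ _ → identityˡ
    ; zag = λ A → trans identityʳ (mono (elem A) _ _
        (proj₂ (comprehension-factors (inclusion A)))) }
    where
      inclusion : ∀ A → ElementHom Sub (dom (elem A) ,ₑ maximal (dom (elem A))) A
      inclusion A = arrow (elem A) ,ₕ
        -- A subobject pulled back along its own inclusion is maximal.
        factors⇒*-maximal (elem A) (factors-self (elem A))

  plainDTT : IsPlainDTT (∫-proj Sub) (∫-proj y𝟏) Σ⊤ Δ⊤ Σ⊤⊣Δ⊤
  plainDTT = record
    { ctx-terminal = terminal
    ; u-fibration = ∫-fibration Sub
    ; u̇-fibration = ∫-fibration y𝟏
    ; u∘S≡u̇ = record { eq₀ = λ _ → ≡.refl ; eq₁ = λ _ → refl }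
    ; S-cartesian = λ f _ → ∫-cartesian Sub (Functor.F₁ Σ⊤ f)
    ; Δ-cartesian = λ f _ → ∫-cartesian y𝟏 (Functor.F₁ Δ⊤ f)
    ; unit-cartesian = λ A → ∫-cartesian y𝟏 (_⊣_.unit.η Σ⊤⊣Δ⊤ A)
    ; counit-cartesian = λ A → ∫-cartesian Sub (_⊣_.counit.η Σ⊤⊣Δ⊤ A) }

mainTheorem18 :
    ∀ {o ℓ e oⱼ ℓⱼ eⱼ : Level} (C : Category o ℓ e) (T : PredicativeTopos oⱼ ℓⱼ eⱼ C) →
    let open PredicativeTopos T
        𝟏 = Terminal.𝟏 terminal
        Σ⊤ = ∫-map (y 𝟏) Sub ⊤ₛ
    in
    (∀ (Γ : Category.Obj C) (φ : Psh C [ y Γ , Sub ]) →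
       Σ[ pb ∈ Pullback (Psh C) φ ⊤ₛ ] Representable (Pullback.P pb))
    × (Σ[ Δ⊤ ∈ Functor (∫ Sub) (∫ (y 𝟏)) ]
       Σ[ Σ⊤⊣Δ⊤ ∈ Σ⊤ ⊣ Δ⊤ ]
       IsPlainDTT (∫-proj Sub) (∫-proj (y 𝟏)) Σ⊤ Δ⊤ Σ⊤⊣Δ⊤)
mainTheorem18 C T =
  -- The apex was chosen to be a representable presheaf, so the identity isomorphism suffices.
  (λ Γ φ → ⊤-pullback fc φ , Subobject.dom (classified fc φ) , ≅-refl (Psh C)) ,
  Δ⊤ fc , Σ⊤⊣Δ⊤ fc , plainDTT fc
  where
    open PredicativeTopos T using (Subobject; module Subobject)
      renaming (finitelyComplete to fc)
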